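{- Let $n > 3$ be an integer and let $Q_n^2$ be the square of the hypercube $Q_n$. Then each of the eigenvalues of $Q_n^2$ is of the form $$\lambda_i = \tfrac{1}{2}n(n+1) - 2i(n+1) + 2i^2, \qquad 0 \le i \le \left\lfloor \tfrac{n+1}{2}\right\rfloor .$$ Moreover, the multiplicity of $\lambda_0$ is $1$, and writing $m(\lambda_i)$ for the multiplicity of $\lambda_i$: (a) if $n$ is even, then $m(\lambda_i) = \binom{n}{i} + \binom{n}{n+1-i}$ for $1 \le i \le \lfloor \frac{n+1}{2}\rfloor$; (b) if $n$ is odd, then $m(\lambda_i) = \binom{n}{i} + \binom{n}{n+1-i}$ for $1 \le i < \lfloor \frac{n+1}{2}\rfloor$, and $m(\lambda_j) = \binom{n}{j}$ for $j = \lfloor \frac{n+1}{2}\rfloor$.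
   Context: All graphs are finite, simple and undirected. The hypercube $Q_n$ is the graph with vertex set $\{0,1\}^n$ in which two $n$-tuples are adjacent if and only if they differ in precisely one coordinate. For a graph $\Gamma=(V,E)$, the square $\Gamma^2$ is the simple graph with vertex set $V$ in which two distinct vertices are adjacent if and only if their distance in $\Gamma$ is at most two. The eigenvalues of a graph, and their multiplicities, are those of its adjacency matrix (the $0/1$ matrix indexed by the vertices with entry $1$ exactly at adjacent pairs). -}

module Defs where

open import Algebra.Apartness.Bundles using (HeytingField; HeytingCommutativeRing)
open import Algebra.Bundles using (CommutativeRing)
import Algebra.Definitions.RawMonoid as RawMonoidDefinitions
open import Data.Bool.Base using (Bool; if_then_else_)
import Data.Bool.Properties as Bool
open import Data.Fin.Base as Fin using (Fin)
import Data.Fin.Properties as Fin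
open import Data.Integer.Base as ℤ using (ℤ; +_; -[1+_])
open import Data.Nat.Base using (ℕ; zero; suc; _+_; _*_; _^_; _≤_; _<_; s≤s; s≤s⁻¹)
open import Data.Nat.DivMod using (_/_)
import Data.Nat.Properties as ℕ
open import Data.Product using (∃; ∃!; _×_; _,_; uncurry)
open import Data.Product.Function.NonDependent.Propositional using (_×-↔_)
open import Data.Vec.Base using (Vec; []; _∷_; lookup)
open import Function.Base using (_∘_)
open import Function.Bundles using (_↔_; mk↔ₛ′; module Inverse)
open import Function.Construct.Composition using (_↔-∘_)
open import Level using (Level; _⊔_)
open import Relation.Binary.Definitions using (Decidable; DecidableEquality; Symmetric)
open import Relation.Binary.PropositionalEquality
open import Relation.Nullary using (¬_; Dec; does)
open import Relation.Nullary.Decidable using (map′; _×-dec_; _→-dec_; ¬?)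

record FiniteSimpleGraph : Set₁ where
  field
    V       : Set
    size    : ℕ
    enum    : Fin size ↔ V
    Adj     : V → V → Set
    adj?    : Decidable Adj
    adj-sym : Symmetric Adj
    irrefl  : ∀ {v} → ¬ Adj v v

  vertex : Fin size → V
  vertex = Inverse.to enum

  index : V → Fin size
  index = Inverse.from enum

  vertex-index : ∀ v → vertex (index v) ≡ v
  vertex-index = Inverse.strictlyInverseˡ enum

  _≟ᵥ_ : DecidableEquality V
  u ≟ᵥ v = map′
    (λ eq → trans (sym (vertex-index u)) (trans (cong vertex eq) (vertex-index v)))
    (cong index)
    (index u Fin.≟ index v)

  any-vertex? : {P : V → Set} → (∀ v → Dec (P v)) → Dec (∃ P)
  any-vertex? {P} P? = map′
    (λ (i , p) → vertex i , p)
    (λ (v , p) → index v , subst P (sym (vertex-index v)) p)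
    (Fin.any? (P? ∘ vertex))

  data Walk : ℕ → V → V → Set where
    stop : ∀ {v} → Walk 0 v v
    step : ∀ {k u v w} → Adj u v → Walk k v w → Walk (suc k) u w

  -- Disconnected vertices are at no distance from each other.
  IsDistance : V → V → ℕ → Set
  IsDistance u v d = Walk d u v × (∀ k → Walk k u v → d ≤ k)

  snoc : ∀ {k u v w} → Walk k u v → Adj v w → Walk (suc k) u w
  snoc stop       a = step a stop
  snoc (step b p) a = step b (snoc p a)

  reverse : ∀ {k u v} → Walk k u v → Walk k v u
  reverse stop       = stop
  reverse (step a p) = snoc (reverse p) (adj-sym a)

  walk? : ∀ k u v → Dec (Walk k u v)
  walk? zero u v = map′ (λ { refl → stop }) (λ { stop → refl }) (u ≟ᵥ v)
  walk? (suc k) u w = map′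
    (λ (_ , a , p) → step a p)
    (λ { (step a p) → _ , a , p })
    (any-vertex? (λ v → adj? u v ×-dec walk? k v w))

  isDistance? : ∀ u v d → Dec (IsDistance u v d)
  isDistance? u v d = walk? d u v ×-dec
    map′ to from (ℕ.allUpTo? (λ k → ¬? (walk? k u v)) d)
    where
    to : (∀ {k} → k < d → ¬ Walk k u v) → ∀ k → Walk k u v → d ≤ k
    to none k p = ℕ.≮⇒≥ (λ k<d → none k<d p)

    from : (∀ k → Walk k u v → d ≤ k) → ∀ {k} → k < d → ¬ Walk k u v
    from least {k} k<d p = ℕ.<⇒≱ k<d (least k p)

  isDistance-sym : ∀ {u v d} → IsDistance u v d → IsDistance v u d
  isDistance-sym (p , least) = reverse p , λ k q → least k (reverse q)

infixl 8 _²

_² : FiniteSimpleGraph → FiniteSimpleGraph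
Γ ² = record
  { V       = V
  ; size    = size
  ; enum    = enum
  ; Adj     = λ u v → u ≢ v × ∃ λ d → d ≤ 2 × IsDistance u v d
  ; adj?    = λ u v → ¬? (u ≟ᵥ v) ×-dec map′
                (λ (d , d<3 , p) → d , s≤s⁻¹ d<3 , p)
                (λ (d , d≤2 , p) → d , s≤s d≤2 , p)
                (ℕ.anyUpTo? (isDistance? u v) 3)
  ; adj-sym = λ (u≢v , d , d≤2 , p) → u≢v ∘ sym , d , d≤2 , isDistance-sym p
  ; irrefl  = λ (v≢v , _) → v≢v refl
  }
  where open FiniteSimpleGraph Γ

enumTuples : ∀ n → Fin (2 ^ n) ↔ Vec Bool n
enumTuples zero = mk↔ₛ′ (λ _ → []) (λ _ → Fin.zero)
  (λ { [] → refl }) (λ { Fin.zero → refl ; (Fin.suc ()) })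
enumTuples (suc n) = cons ↔-∘ ((Fin.2↔Bool ×-↔ enumTuples n) ↔-∘ Fin.*↔×)
  where
  cons : (Bool × Vec Bool n) ↔ Vec Bool (suc n)
  cons = mk↔ₛ′ (uncurry _∷_) (λ { (b ∷ bs) → b , bs }) (λ { (_ ∷ _) → refl }) (λ _ → refl)

DifferInOneCoordinate : ∀ {n} → Vec Bool n → Vec Bool n → Set
DifferInOneCoordinate u v = ∃! _≡_ λ i → lookup u i ≢ lookup v i

differInOneCoordinate? : ∀ {n} → Decidable (DifferInOneCoordinate {n})
differInOneCoordinate? u v = Fin.any? λ i → differ? i ×-dec map′
  (λ unique {j} → unique j)
  (λ unique j → unique {j})
  (Fin.all? λ j → implies? j i)
  where
  differ? : ∀ i → Dec (lookup u i ≢ lookup v i)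
  differ? i = ¬? (lookup u i Bool.≟ lookup v i)

  implies? : ∀ j i → Dec (lookup u j ≢ lookup v j → i ≡ j)
  implies? j i = differ? j →-dec (i Fin.≟ j)

Q : ℕ → FiniteSimpleGraph
Q n = record
  { V       = Vec Bool n
  ; size    = 2 ^ n
  ; enum    = enumTuples n
  ; Adj     = DifferInOneCoordinate
  ; adj?    = differInOneCoordinate?
  ; adj-sym = λ (i , p , unique) → i , p ∘ sym , λ q → unique (q ∘ sym)
  ; irrefl  = λ (_ , p , _) → p refl
  }

-- The division is exact, since n (n + 1) is even.
lambdaℤ : ℕ → ℕ → ℤ
lambdaℤ n i =
  + (n * (n + 1) / 2) ℤ.- + (2 * i * (n + 1)) ℤ.+ + (2 * i ^ 2)

-- The standard library has no real numbers, so spectra are taken over an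
-- arbitrary Heyting field of characteristic zero: ℝ and ℂ are instances, and
-- classically (with # as ≉) so is every field of characteristic zero.
module Spectrum {c ℓ₁ ℓ₂ : Level} (K : HeytingField c ℓ₁ ℓ₂) where

  private
    module K = HeytingField K
    module R = CommutativeRing (HeytingCommutativeRing.commutativeRing K.heytingCommutativeRing)
  open K using (Carrier; _#_; 0#; 1#)
  open K public using (_≈_)

  open RawMonoidDefinitions R.+-rawMonoid using (sum) renaming (_×_ to _×ᴷ_)

  CharacteristicZero : Set ℓ₂
  CharacteristicZero = ∀ m → (suc m ×ᴷ 1#) # 0#

  fromℤ : ℤ → Carrier
  fromℤ (+ m)      = m ×ᴷ 1#
  fromℤ -[1+ m ]   = K.- (suc m ×ᴷ 1#)

  lambda : ℕ → ℕ → Carrier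
  lambda n i = fromℤ (lambdaℤ n i)

  module _ (Γ : FiniteSimpleGraph) where

    open FiniteSimpleGraph Γ

    adjacencyMatrix : V → V → Carrier
    adjacencyMatrix u v = if does (adj? u v) then 1# else 0#

    applyAdjacency : (V → Carrier) → (V → Carrier)
    applyAdjacency x u = sum λ k → adjacencyMatrix u (vertex k) K.* x (vertex k)

    InEigenspace : Carrier → (V → Carrier) → Set ℓ₁
    InEigenspace μ x = ∀ u → applyAdjacency x u ≈ μ K.* x u

    IsEigenvalue : Carrier → Set (c ⊔ ℓ₁ ⊔ ℓ₂)
    IsEigenvalue μ = ∃ λ x → (∃ λ u → x u # 0#) × InEigenspace μ x

    linearCombination : ∀ {m} → (Fin m → Carrier) → (Fin m → V → Carrier) → V → Carrier
    linearCombination a b u = sum λ j → a j K.* b j u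

    LinearlyIndependent : ∀ {m} → (Fin m → V → Carrier) → Set (c ⊔ ℓ₁)
    LinearlyIndependent b =
      ∀ a → (∀ u → linearCombination a b u ≈ 0#) → ∀ j → a j ≈ 0#

    -- Multiplicity as the dimension of the eigenspace; for the symmetric
    -- adjacency matrix over ℝ it agrees with the algebraic multiplicity.
    HasMultiplicity : Carrier → ℕ → Set (c ⊔ ℓ₁)
    HasMultiplicity μ m = ∃ λ (b : Fin m → V → Carrier) →
        (∀ j → InEigenspace μ (b j))
      × LinearlyIndependent b
      × (∀ x → InEigenspace μ x → ∃ λ a → ∀ u → x u ≈ linearCombination a b u)

{-# OPTIONS --safe #-}
-- The characters χ S of (ℤ/2)ⁿ diagonalise every graph on {0,1}ⁿ whose
-- adjacency depends only on Hamming distance. Adjacency in Q n ² means distance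
-- 1 or 2, so the eigenvalue at χ S is K₁(∣S∣) + K₂(∣S∣) with Kₖ the Krawtchouk
-- polynomials, which is λ_∣S∣. As λ_i − λ_j = 2 (i − j) (i + j − n − 1), the
-- levels ∣S∣ = i and ∣S∣ = n + 1 − i, and no others, share an eigenvalue.
-- Fourier inversion shows that the corresponding characters span the eigenspace,
-- and orthogonality that they are independent.
module Submission where

open import Defs
open import Algebra.Apartness.Bundles using (HeytingField; HeytingCommutativeRing)
import Algebra.Apartness.Properties.HeytingCommutativeRing as HeytingCommutativeRingProperties
open import Algebra.Bundles using (CommutativeRing)
import Algebra.Properties.AbelianGroup as AbelianGroupProperties
import Algebra.Properties.CommutativeMonoid.Sum as CommutativeMonoidSum
import Algebra.Properties.CommutativeSemigroup as CommutativeSemigroupProperties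
import Algebra.Properties.Monoid.Mult as Mult
import Algebra.Properties.Ring as RingProperties
import Algebra.Properties.Semiring.Sum as SemiringSum
open import Axiom.UniquenessOfIdentityProofs using (module Decidable⇒UIP)
open import Data.Bool.Base using (Bool; true; false; not; _xor_; if_then_else_)
import Data.Bool.Properties as Bool
open import Data.Fin.Base as Fin using (Fin; _↑ˡ_; _↑ʳ_)
import Data.Fin.Properties as Fin
open import Data.Fin.Subset using (∣_∣)
open import Data.Fin.Subset.Properties using (∣p∣≤n)
open import Data.Integer.Base as ℤ using (ℤ; +_; -[1+_]; _⊖_; 0ℤ; 1ℤ)
import Data.Integer.Properties as ℤ
open import Data.Integer.Tactic.RingSolver using (solve-∀)
open import Data.Nat.Base as ℕ using (ℕ; zero; suc; _^_)
open import Data.Nat.Combinatorics using (_C_; k>n⇒nCk≡0; nCk+nC[k+1]≡[n+1]C[k+1])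
open import Data.Nat.Divisibility
  using (_∣_; _∤_; divides; ∣m⇒∣m*n; ∣n⇒∣m*n; m%n≡0⇒n∣m; ∣m+n∣m⇒∣n; ∣1⇒≡1)
open import Data.Nat.DivMod using (_/_; _%_; m/n*n≡m; m≡m%n+[m/n]*n; m%n<n; m/n*n≤m)
import Data.Nat.Properties as ℕ
open import Data.Product.Base using (∃; _×_; _,_; proj₁; proj₂)
open import Data.Sum.Base using (_⊎_; inj₁; inj₂; [_,_]′; map₂; fromInj₁; fromInj₂)
open import Data.Sum.Function.Propositional using (_⊎-↔_)
open import Data.Vec.Base using (Vec; []; _∷_; lookup; zipWith)
import Data.Vec.Properties as Vec
open import Function.Base using (_∘_; _$_)
open import Function.Bundles
  using (_↔_; _⇔_; mk↔ₛ′; mk⇔; module Inverse; module Equivalence)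
open import Function.Construct.Composition using (_↔-∘_)
import Relation.Binary.PropositionalEquality as ≡
open ≡ using (_≡_; _≢_)
import Relation.Binary.Reasoning.Setoid as SetoidReasoning
open import Relation.Nullary using (¬_; Dec; yes; no; does; contradiction)
open import Relation.Nullary.Decidable using (decidable-stable; does-⇔; _⊎-dec_)
open import Relation.Unary using (Irrelevant)

-- Two features shape the form of the argument. In a Heyting field neither equality nor apartness is
-- assumed decidable, so an eigenvalue cannot be matched with some λ_i by testing the characters one
-- after another. Instead, a sum apart from zero yields a summand apart from zero, and Fourier
-- inversion at a coordinate where the eigenvector is apart from zero thereby delivers a suitable S.
-- The case distinctions on eigenvalues are made on integers: a fibre of λ is the set of all S that
-- satisfy an integer equation, and its size is given by an explicit bijection with `Fin m`.
-- Characteristic zero enters in two ways: it makes 2ⁿ invertible, and it keeps the images of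
-- distinct integers apart.

module Hypercube where

  open import Data.Nat.Base using (_+_; _*_; _∸_; _≤_; _<_; z≤n; s≤s)
  open ≡
  open Decidable⇒UIP ℤ._≟_ public using () renaming (≡-irrelevant to ℤ-≡-irrelevant)

  private variable
    n k : ℕ

  open FiniteSimpleGraph using (Walk; stop; step)

  -- Hamming distance and adjacency in the square of the hypercube.

  hamming : Vec Bool n → Vec Bool n → ℕ
  hamming u v = ∣ zipWith _xor_ u v ∣

  hamming-sym : ∀ (u v : Vec Bool n) → hamming u v ≡ hamming v u
  hamming-sym u v = cong ∣_∣ (Vec.zipWith-comm Bool.xor-comm u v)

  hamming-refl : ∀ (u : Vec Bool n) → hamming u u ≡ 0
  hamming-refl []          = refl
  hamming-refl (true  ∷ u) = hamming-refl u
  hamming-refl (false ∷ u) = hamming-refl u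

  hamming≡0⇒≡ : ∀ (u v : Vec Bool n) → hamming u v ≡ 0 → u ≡ v
  hamming≡0⇒≡ []          []          _ = refl
  hamming≡0⇒≡ (true  ∷ u) (true  ∷ v) p = cong (true ∷_) (hamming≡0⇒≡ u v p)
  hamming≡0⇒≡ (false ∷ u) (false ∷ v) p = cong (false ∷_) (hamming≡0⇒≡ u v p)

  hamming-triangle : ∀ (u v w : Vec Bool n) → hamming u w ≤ hamming u v + hamming v w
  hamming-triangle [] [] [] = z≤n
  hamming-triangle (true  ∷ u) (true  ∷ v) (true  ∷ w) = hamming-triangle u v w
  hamming-triangle (false ∷ u) (false ∷ v) (false ∷ w) = hamming-triangle u v w
  hamming-triangle (true  ∷ u) (false ∷ v) (false ∷ w) = s≤s (hamming-triangle u v w)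
  hamming-triangle (false ∷ u) (true  ∷ v) (true  ∷ w) = s≤s (hamming-triangle u v w)
  hamming-triangle (true  ∷ u) (true  ∷ v) (false ∷ w) =
    ℕ.≤-trans (s≤s (hamming-triangle u v w)) (ℕ.≤-reflexive (sym (ℕ.+-suc _ _)))
  hamming-triangle (false ∷ u) (false ∷ v) (true  ∷ w) =
    ℕ.≤-trans (s≤s (hamming-triangle u v w)) (ℕ.≤-reflexive (sym (ℕ.+-suc _ _)))
  hamming-triangle (true  ∷ u) (false ∷ v) (true  ∷ w) =
    ℕ.≤-trans (hamming-triangle u v w) (ℕ.+-mono-≤ (ℕ.n≤1+n _) (ℕ.n≤1+n _))
  hamming-triangle (false ∷ u) (true  ∷ v) (false ∷ w) =
    ℕ.≤-trans (hamming-triangle u v w) (ℕ.+-mono-≤ (ℕ.n≤1+n _) (ℕ.n≤1+n _))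

  lookup-ext : ∀ (u v : Vec Bool n) → (∀ i → lookup u i ≡ lookup v i) → u ≡ v
  lookup-ext []      []      _ = refl
  lookup-ext (_ ∷ u) (_ ∷ v) p = cong₂ _∷_ (p Fin.zero) (lookup-ext u v (p ∘ Fin.suc))

  private
    differ-tail : ∀ {b} {u v : Vec Bool n} →
      DifferInOneCoordinate (b ∷ u) (b ∷ v) → DifferInOneCoordinate u v
    differ-tail (Fin.zero  , p , _)      = contradiction refl p
    differ-tail (Fin.suc i , p , unique) = i , p , λ q → Fin.suc-injective (unique {Fin.suc _} q)

    differ-cons : ∀ {b} {u v : Vec Bool n} →
      DifferInOneCoordinate u v → DifferInOneCoordinate (b ∷ u) (b ∷ v)
    differ-cons {b = b} {u} {v} (i , p , unique) = Fin.suc i , p , unique′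
      where
      unique′ : ∀ {j} → lookup (b ∷ u) j ≢ lookup (b ∷ v) j → Fin.suc i ≡ j
      unique′ {Fin.zero}  q = contradiction refl q
      unique′ {Fin.suc j} q = cong Fin.suc (unique q)

    -- Uniqueness forces the differing coordinate to be the head. A difference in the tail would
    -- contradict this, and decidable equality of booleans turns the absence of a difference into
    -- equality.
    differ-head⇒≡ : ∀ {b c} {u v : Vec Bool n} → b ≢ c →
      DifferInOneCoordinate (b ∷ u) (c ∷ v) → u ≡ v
    differ-head⇒≡ {u = u} {v} b≢c (i , _ , unique) with unique {Fin.zero} b≢c
    ... | refl = lookup-ext u v λ j →
      decidable-stable (lookup u j Bool.≟ lookup v j) λ q → Fin.0≢1+n (unique {Fin.suc j} q)

    differ-head : ∀ {b c} {u v : Vec Bool n} → b ≢ c → u ≡ v →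
      DifferInOneCoordinate (b ∷ u) (c ∷ v)
    differ-head {b = b} {c} {u} b≢c refl = Fin.zero , b≢c , unique
      where
      unique : ∀ {j} → lookup (b ∷ u) j ≢ lookup (c ∷ u) j → Fin.zero ≡ j
      unique {Fin.zero}  _ = refl
      unique {Fin.suc j} q = contradiction refl q

  differ⇒hamming≡1 : ∀ (u v : Vec Bool n) → DifferInOneCoordinate u v → hamming u v ≡ 1
  differ⇒hamming≡1 [] [] (() , _)
  differ⇒hamming≡1 (true  ∷ u) (true  ∷ v) d = differ⇒hamming≡1 u v (differ-tail d)
  differ⇒hamming≡1 (false ∷ u) (false ∷ v) d = differ⇒hamming≡1 u v (differ-tail d)
  differ⇒hamming≡1 (true  ∷ u) (false ∷ v) d with refl ← differ-head⇒≡ (λ ()) d =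
    cong suc (hamming-refl u)
  differ⇒hamming≡1 (false ∷ u) (true  ∷ v) d with refl ← differ-head⇒≡ (λ ()) d =
    cong suc (hamming-refl u)

  hamming≡1⇒differ : ∀ (u v : Vec Bool n) → hamming u v ≡ 1 → DifferInOneCoordinate u v
  hamming≡1⇒differ [] [] ()
  hamming≡1⇒differ (true  ∷ u) (true  ∷ v) p = differ-cons (hamming≡1⇒differ u v p)
  hamming≡1⇒differ (false ∷ u) (false ∷ v) p = differ-cons (hamming≡1⇒differ u v p)
  hamming≡1⇒differ (true  ∷ u) (false ∷ v) p =
    differ-head (λ ()) (hamming≡0⇒≡ u v (ℕ.suc-injective p))
  hamming≡1⇒differ (false ∷ u) (true  ∷ v) p =
    differ-head (λ ()) (hamming≡0⇒≡ u v (ℕ.suc-injective p))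

  walk⇒hamming≤ : ∀ {u v : Vec Bool n} → Walk (Q n) k u v → hamming u v ≤ k
  walk⇒hamming≤ {u = u} stop = ℕ.≤-reflexive (hamming-refl u)
  walk⇒hamming≤ {u = u} {w} (step {v = v} a p) = ℕ.≤-trans (hamming-triangle u v w)
    (ℕ.+-mono-≤ (ℕ.≤-reflexive (differ⇒hamming≡1 u v a)) (walk⇒hamming≤ p))

  cons-walk : ∀ b {u v : Vec Bool n} → Walk (Q n) k u v → Walk (Q (suc n)) k (b ∷ u) (b ∷ v)
  cons-walk b stop       = stop
  cons-walk b (step a p) = step (differ-cons a) (cons-walk b p)

  hamming-walk : ∀ (u v : Vec Bool n) → Walk (Q n) (hamming u v) u v
  hamming-walk []          []          = stop
  hamming-walk (true  ∷ u) (true  ∷ v) = cons-walk true (hamming-walk u v)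
  hamming-walk (false ∷ u) (false ∷ v) = cons-walk false (hamming-walk u v)
  hamming-walk (true  ∷ u) (false ∷ v) =
    step (differ-head (λ ()) refl) (cons-walk false (hamming-walk u v))
  hamming-walk (false ∷ u) (true  ∷ v) =
    step (differ-head (λ ()) refl) (cons-walk true (hamming-walk u v))

  -- Hamming distance bounds the length of every walk from below and `hamming-walk` attains it, so
  -- it is the graph distance. The value 0 is excluded because adjacent vertices are distinct.
  Adj²⇔hamming : ∀ (u v : Vec Bool n) →
    FiniteSimpleGraph.Adj (Q n ²) u v ⇔ (hamming u v ≡ 1 ⊎ hamming u v ≡ 2)
  Adj²⇔hamming {n} u v = mk⇔ to from
    where
    to : FiniteSimpleGraph.Adj (Q n ²) u v → hamming u v ≡ 1 ⊎ hamming u v ≡ 2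
    to (u≢v , d , d≤2 , walk , _)
      with hamming u v in eq | ℕ.≤-trans (walk⇒hamming≤ walk) d≤2
    ... | 0 | _ = contradiction (hamming≡0⇒≡ u v eq) u≢v
    ... | 1 | _ = inj₁ refl
    ... | 2 | _ = inj₂ refl
    ... | suc (suc (suc _)) | s≤s (s≤s ())

    from′ : hamming u v ≢ 0 → hamming u v ≤ 2 → FiniteSimpleGraph.Adj (Q n ²) u v
    from′ h≢0 h≤2 =
      (λ { refl → h≢0 (hamming-refl u) }) ,
      hamming u v , h≤2 , hamming-walk u v , λ _ → walk⇒hamming≤

    from : hamming u v ≡ 1 ⊎ hamming u v ≡ 2 → FiniteSimpleGraph.Adj (Q n ²) u v
    from (inj₁ p) = from′ (λ q → ℕ.0≢1+n (trans (sym q) p)) (subst (_≤ 2) (sym p) (s≤s z≤n))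
    from (inj₂ p) = from′ (λ q → ℕ.0≢1+n (trans (sym q) p)) (subst (_≤ 2) (sym p) (s≤s (s≤s z≤n)))

  -- Krawtchouk polynomials.

  -- Eigenvalue of the distance-k graph of Q n at the character of S, i.e. the
  -- Krawtchouk polynomial K_k(∣S∣), through its generating function
  -- (1 - x)^∣S∣ (1 + x)^(n - ∣S∣).
  krawtchouk : ℕ → Vec Bool n → ℤ
  krawtchouk zero    S           = 1ℤ
  krawtchouk (suc k) []          = 0ℤ
  krawtchouk (suc k) (true  ∷ S) = krawtchouk (suc k) S ℤ.- krawtchouk k S
  krawtchouk (suc k) (false ∷ S) = krawtchouk (suc k) S ℤ.+ krawtchouk k S

  -- This is the sum of `n` signs, of which ∣S∣ are -1.
  krawtchouk₁ : ∀ (S : Vec Bool n) → krawtchouk 1 S ≡ + n ℤ.- + 2 ℤ.* + ∣ S ∣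
  krawtchouk₁ [] = refl
  krawtchouk₁ {suc n} (true ∷ S) =
    trans (cong (ℤ._- 1ℤ) (krawtchouk₁ S)) (lemma (+ n) (+ ∣ S ∣))
    where
    lemma : ∀ a b → a ℤ.- + 2 ℤ.* b ℤ.- 1ℤ ≡ 1ℤ ℤ.+ a ℤ.- + 2 ℤ.* (1ℤ ℤ.+ b)
    lemma = solve-∀
  krawtchouk₁ {suc n} (false ∷ S) =
    trans (cong (ℤ._+ 1ℤ) (krawtchouk₁ S)) (lemma (+ n) (+ ∣ S ∣))
    where
    lemma : ∀ a b → a ℤ.- + 2 ℤ.* b ℤ.+ 1ℤ ≡ 1ℤ ℤ.+ a ℤ.- + 2 ℤ.* b
    lemma = solve-∀

  -- Newton's identity 2e₂ = e₁² - p₂ for the `n` signs, whose squares add up to `n`. The factor 2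
  -- keeps it free of division.
  2*krawtchouk₂ : ∀ (S : Vec Bool n) →
    + 2 ℤ.* krawtchouk 2 S ≡ krawtchouk 1 S ℤ.* krawtchouk 1 S ℤ.- + n
  2*krawtchouk₂ [] = refl
  2*krawtchouk₂ {suc n} (true ∷ S) =
    trans (expand (krawtchouk 2 S) (krawtchouk 1 S))
    (trans (cong (ℤ._- + 2 ℤ.* krawtchouk 1 S) (2*krawtchouk₂ S))
           (square (krawtchouk 1 S) (+ n)))
    where
    expand : ∀ a b → + 2 ℤ.* (a ℤ.- b) ≡ + 2 ℤ.* a ℤ.- + 2 ℤ.* b
    expand = solve-∀
    square : ∀ b n → b ℤ.* b ℤ.- n ℤ.- + 2 ℤ.* b ≡ (b ℤ.- 1ℤ) ℤ.* (b ℤ.- 1ℤ) ℤ.- (1ℤ ℤ.+ n)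
    square = solve-∀
  2*krawtchouk₂ {suc n} (false ∷ S) =
    trans (expand (krawtchouk 2 S) (krawtchouk 1 S))
    (trans (cong (ℤ._+ + 2 ℤ.* krawtchouk 1 S) (2*krawtchouk₂ S))
           (square (krawtchouk 1 S) (+ n)))
    where
    expand : ∀ a b → + 2 ℤ.* (a ℤ.+ b) ≡ + 2 ℤ.* a ℤ.+ + 2 ℤ.* b
    expand = solve-∀
    square : ∀ b n → b ℤ.* b ℤ.- n ℤ.+ + 2 ℤ.* b ≡ (b ℤ.+ 1ℤ) ℤ.* (b ℤ.+ 1ℤ) ℤ.- (1ℤ ℤ.+ n)
    square = solve-∀

  -- Integer arithmetic of the values λ_i.

  2∣n⊎2∣n+1 : ∀ n → (2 ∣ n) ⊎ (2 ∣ n + 1)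
  2∣n⊎2∣n+1 n with n % 2 in eq | m%n<n n 2
  ... | 0 | _ = inj₁ (m%n≡0⇒n∣m n 2 eq)
  ... | 1 | _ = inj₂ (divides (suc (n / 2))
    (trans (ℕ.+-comm n 1) (cong suc (trans (m≡m%n+[m/n]*n n 2) (cong (_+ n / 2 * 2) eq)))))
  ... | suc (suc _) | s≤s (s≤s ())

  2∣n[n+1] : ∀ n → 2 ∣ n * (n + 1)
  2∣n[n+1] n = [ ∣m⇒∣m*n (n + 1) , ∣n⇒∣m*n n ]′ (2∣n⊎2∣n+1 n)

  -- Doubling clears the halving, which is exact by `2∣n[n+1]`, and leaves a polynomial in n and i
  -- for the ring solver. Later equations between values of `lambdaℤ` are proved for multiples and
  -- then cancelled.
  2*lambdaℤ : ∀ n i → + 2 ℤ.* lambdaℤ n i ≡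
    + n ℤ.* (+ n ℤ.+ 1ℤ) ℤ.- + 4 ℤ.* + i ℤ.* (+ n ℤ.+ 1ℤ) ℤ.+ + 4 ℤ.* + i ℤ.* + i
  2*lambdaℤ n i = trans (expand (+ (n * (n + 1) / 2)) (+ (2 * i * (n + 1))) (+ (2 * i ^ 2)))
    (trans (cong₂ ℤ._+_ (cong₂ ℤ._-_ triangle linear) square) (lemma (+ n) (+ i)))
    where
    expand : ∀ a b c → + 2 ℤ.* (a ℤ.- b ℤ.+ c) ≡ a ℤ.* + 2 ℤ.- + 2 ℤ.* b ℤ.+ + 2 ℤ.* c
    expand = solve-∀

    triangle : + (n * (n + 1) / 2) ℤ.* + 2 ≡ + n ℤ.* (+ n ℤ.+ 1ℤ)
    triangle = trans (sym (ℤ.pos-* (n * (n + 1) / 2) 2))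
      (trans (cong +_ (m/n*n≡m (2∣n[n+1] n))) (ℤ.pos-* n (n + 1)))

    linear : + 2 ℤ.* + (2 * i * (n + 1)) ≡ + 2 ℤ.* (+ 2 ℤ.* + i ℤ.* (+ n ℤ.+ 1ℤ))
    linear = cong (+ 2 ℤ.*_)
      (trans (ℤ.pos-* (2 * i) (n + 1)) (cong (ℤ._* (+ n ℤ.+ 1ℤ)) (ℤ.pos-* 2 i)))

    square : + 2 ℤ.* + (2 * i ^ 2) ≡ + 2 ℤ.* (+ 2 ℤ.* (+ i ℤ.* + i))
    square = cong (+ 2 ℤ.*_) (trans (ℤ.pos-* 2 (i ^ 2)) (cong (+ 2 ℤ.*_)
      (trans (ℤ.pos-* i (i * 1)) (cong ((+ i ℤ.*_) ∘ +_) (ℕ.*-identityʳ i)))))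

    lemma : ∀ n i →
      n ℤ.* (n ℤ.+ 1ℤ) ℤ.- + 2 ℤ.* (+ 2 ℤ.* i ℤ.* (n ℤ.+ 1ℤ)) ℤ.+ + 2 ℤ.* (+ 2 ℤ.* (i ℤ.* i)) ≡
      n ℤ.* (n ℤ.+ 1ℤ) ℤ.- + 4 ℤ.* i ℤ.* (n ℤ.+ 1ℤ) ℤ.+ + 4 ℤ.* i ℤ.* i
    lemma = solve-∀

  krawtchouk₁+₂ : ∀ (S : Vec Bool n) →
    krawtchouk 1 S ℤ.+ krawtchouk 2 S ≡ lambdaℤ n ∣ S ∣
  krawtchouk₁+₂ {n} S = ℤ.*-cancelˡ-≡ (+ 2) _ _ $ begin
    + 2 ℤ.* (krawtchouk 1 S ℤ.+ krawtchouk 2 S)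
      ≡⟨ ℤ.*-distribˡ-+ (+ 2) (krawtchouk 1 S) (krawtchouk 2 S) ⟩
    + 2 ℤ.* krawtchouk 1 S ℤ.+ + 2 ℤ.* krawtchouk 2 S
      ≡⟨ cong (λ z → + 2 ℤ.* krawtchouk 1 S ℤ.+ z) (2*krawtchouk₂ S) ⟩
    + 2 ℤ.* krawtchouk 1 S ℤ.+ (krawtchouk 1 S ℤ.* krawtchouk 1 S ℤ.- + n)
      ≡⟨ cong (λ z → + 2 ℤ.* z ℤ.+ (z ℤ.* z ℤ.- + n)) (krawtchouk₁ S) ⟩
    + 2 ℤ.* a ℤ.+ (a ℤ.* a ℤ.- + n)
      ≡⟨ lemma (+ n) (+ ∣ S ∣) ⟩
    + n ℤ.* (+ n ℤ.+ 1ℤ) ℤ.- + 4 ℤ.* + ∣ S ∣ ℤ.* (+ n ℤ.+ 1ℤ) ℤ.+ + 4 ℤ.* + ∣ S ∣ ℤ.* + ∣ S ∣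
      ≡⟨ 2*lambdaℤ n ∣ S ∣ ⟨
    + 2 ℤ.* lambdaℤ n ∣ S ∣ ∎
    where
    open ≡-Reasoning
    a = + n ℤ.- + 2 ℤ.* + ∣ S ∣
    lemma : ∀ n i →
      + 2 ℤ.* (n ℤ.- + 2 ℤ.* i) ℤ.+ ((n ℤ.- + 2 ℤ.* i) ℤ.* (n ℤ.- + 2 ℤ.* i) ℤ.- n) ≡
      n ℤ.* (n ℤ.+ 1ℤ) ℤ.- + 4 ℤ.* i ℤ.* (n ℤ.+ 1ℤ) ℤ.+ + 4 ℤ.* i ℤ.* i
    lemma = solve-∀

  -- The 4 is the leading 2 of the factorised difference times the 2 that clears the halving in
  -- `lambdaℤ`.
  4*lambdaℤ-difference : ∀ n i j →
    + 4 ℤ.* ((+ i ℤ.- + j) ℤ.* (+ i ℤ.+ + j ℤ.- (+ n ℤ.+ 1ℤ))) ≡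
    + 2 ℤ.* lambdaℤ n i ℤ.- + 2 ℤ.* lambdaℤ n j
  4*lambdaℤ-difference n i j =
    trans (lemma (+ n) (+ i) (+ j)) (sym (cong₂ ℤ._-_ (2*lambdaℤ n i) (2*lambdaℤ n j)))
    where
    lemma : ∀ n i j → + 4 ℤ.* ((i ℤ.- j) ℤ.* (i ℤ.+ j ℤ.- (n ℤ.+ 1ℤ))) ≡
      (n ℤ.* (n ℤ.+ 1ℤ) ℤ.- + 4 ℤ.* i ℤ.* (n ℤ.+ 1ℤ) ℤ.+ + 4 ℤ.* i ℤ.* i) ℤ.-
      (n ℤ.* (n ℤ.+ 1ℤ) ℤ.- + 4 ℤ.* j ℤ.* (n ℤ.+ 1ℤ) ℤ.+ + 4 ℤ.* j ℤ.* j)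
    lemma = solve-∀

  lambdaℤ-fibre : ∀ n i j → lambdaℤ n i ≡ lambdaℤ n j → i ≡ j ⊎ i + j ≡ n + 1
  lambdaℤ-fibre n i j eq =
    [ inj₁ ∘ ℤ.+-injective ∘ ℤ.i-j≡0⇒i≡j _ _
    , inj₂ ∘ ℤ.+-injective ∘ ℤ.i-j≡0⇒i≡j _ _
    ]′ (ℤ.i*j≡0⇒i≡0∨j≡0 (+ i ℤ.- + j) {+ i ℤ.+ + j ℤ.- (+ n ℤ.+ 1ℤ)}
         (ℤ.*-cancelˡ-≡ (+ 4) _ _ (trans (4*lambdaℤ-difference n i j)
           (ℤ.i≡j⇒i-j≡0 (cong (+ 2 ℤ.*_) eq)))))

  lambdaℤ-reflect : ∀ n i j → i + j ≡ n + 1 → lambdaℤ n i ≡ lambdaℤ n j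
  lambdaℤ-reflect n i j eq = ℤ.*-cancelˡ-≡ (+ 2) _ _ $ ℤ.i-j≡0⇒i≡j _ _ $
    trans (sym (4*lambdaℤ-difference n i j)) $
    cong (+ 4 ℤ.*_) $ trans
      (cong ((+ i ℤ.- + j) ℤ.*_) (ℤ.i≡j⇒i-j≡0 (cong +_ eq)))
      (ℤ.*-zeroʳ (+ i ℤ.- + j))

  -- Counting the layers and the fibres of λ by bijections.

  Layer : ℕ → ℕ → Set
  Layer n k = ∃ λ (S : Vec Bool n) → ∣ S ∣ ≡ k

  Layer-zero : Layer n 0 ↔ Layer (suc n) 0
  Layer-zero = mk↔ₛ′
    (λ (S , p) → false ∷ S , p)
    (λ { (false ∷ S , p) → S , p })
    (λ { (false ∷ _ , _) → refl })
    (λ { (_ , _) → refl })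

  -- Pascal's rule as a bijection: either the first coordinate belongs to the set and leaves k
  -- elements for the tail, or it does not and leaves k + 1.
  Layer-suc : (Layer n k ⊎ Layer n (suc k)) ↔ Layer (suc n) (suc k)
  Layer-suc = mk↔ₛ′
    (λ { (inj₁ (S , p)) → true ∷ S , cong suc p ; (inj₂ (S , p)) → false ∷ S , p })
    (λ { (true ∷ S , p) → inj₁ (S , ℕ.suc-injective p) ; (false ∷ S , p) → inj₂ (S , p) })
    (λ { (true ∷ S , p) → cong (true ∷ S ,_) (ℕ.≡-irrelevant _ _) ; (false ∷ S , p) → refl })
    (λ { (inj₁ (S , p)) → cong (inj₁ ∘ (S ,_)) (ℕ.≡-irrelevant _ _) ; (inj₂ _) → refl })

  layer-enum : ∀ n k → Fin (n C k) ↔ Layer n k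
  layer-enum zero zero = mk↔ₛ′ (λ _ → [] , refl) (λ _ → Fin.zero)
    (λ { ([] , refl) → refl }) (λ { Fin.zero → refl ; (Fin.suc ()) })
  layer-enum zero (suc k) = mk↔ₛ′ (λ ()) (λ { ([] , ()) }) (λ { ([] , ()) }) (λ ())
  layer-enum (suc n) zero = Layer-zero ↔-∘ layer-enum n zero
  layer-enum (suc n) (suc k) = subst (λ m → Fin m ↔ Layer (suc n) (suc k))
    (nCk+nC[k+1]≡[n+1]C[k+1] n k)
    (Layer-suc ↔-∘ ((layer-enum n k ⊎-↔ layer-enum n (suc k)) ↔-∘ Fin.+↔⊎))

  -- The condition is an equation of integers rather than of field elements, so it is decidable and
  -- has at most one proof. Counting the pairs is then the same as counting the vectors `S`.
  LambdaFibre : ℕ → ℤ → Set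
  LambdaFibre n z = ∃ λ (S : Vec Bool n) → lambdaℤ n ∣ S ∣ ≡ z

  module _ {A : Set} {P R : A → Set} (P-irr : Irrelevant P) (R-irr : Irrelevant R) where

    ∃-irrelevant-↔ : (∀ {x} → P x ⇔ R x) → ∃ P ↔ ∃ R
    ∃-irrelevant-↔ P⇔R = mk↔ₛ′
      (λ (x , p) → x , Equivalence.to P⇔R p)
      (λ (x , r) → x , Equivalence.from P⇔R r)
      (λ (x , _) → cong (x ,_) (R-irr _ _))
      (λ (x , _) → cong (x ,_) (P-irr _ _))

  -- Disjointness makes `P x ⊎ Q x` irrelevant: an `x` with both properties would occur twice on the
  -- left.
  ∃-⊎-↔ : ∀ {A : Set} {P Q R : A → Set} → Irrelevant P → Irrelevant Q → Irrelevant R →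
    (∀ {x} → P x → ¬ Q x) → (∀ {x} → (P x ⊎ Q x) ⇔ R x) → (∃ P ⊎ ∃ Q) ↔ ∃ R
  ∃-⊎-↔ {A} {P} {Q} {R} P-irr Q-irr R-irr disjoint P⊎Q⇔R =
    ∃-irrelevant-↔ P⊎Q-irr R-irr P⊎Q⇔R ↔-∘ mk↔ₛ′
      (λ { (inj₁ (x , p)) → x , inj₁ p ; (inj₂ (x , q)) → x , inj₂ q })
      (λ { (x , inj₁ p) → inj₁ (x , p) ; (x , inj₂ q) → inj₂ (x , q) })
      (λ { (x , inj₁ _) → refl ; (x , inj₂ _) → refl })
      (λ { (inj₁ _) → refl ; (inj₂ _) → refl })
    where
    P⊎Q-irr : Irrelevant (λ x → P x ⊎ Q x)
    P⊎Q-irr (inj₁ p) (inj₁ q) = cong inj₁ (P-irr p q)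
    P⊎Q-irr (inj₂ p) (inj₂ q) = cong inj₂ (Q-irr p q)
    P⊎Q-irr (inj₁ p) (inj₂ q) = contradiction q (disjoint p)
    P⊎Q-irr (inj₂ p) (inj₁ q) = contradiction p (disjoint q)

  -- The case i = 0, j = n + 1 is included; there the second layer is empty.
  fibre-two-layers : ∀ {i j} → i + j ≡ n + 1 → i ≢ j →
    (Layer n i ⊎ Layer n j) ↔ LambdaFibre n (lambdaℤ n i)
  fibre-two-layers {n} {i} {j} i+j≡n+1 i≢j =
    ∃-⊎-↔ ℕ.≡-irrelevant ℕ.≡-irrelevant ℤ-≡-irrelevant
      (λ p q → i≢j (trans (sym p) q)) (mk⇔ to from)
    where
    to : ∀ {k} → k ≡ i ⊎ k ≡ j → lambdaℤ n k ≡ lambdaℤ n i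
    to (inj₁ p) = cong (lambdaℤ n) p
    to (inj₂ p) = trans (cong (lambdaℤ n) p) (sym (lambdaℤ-reflect n i j i+j≡n+1))

    from : ∀ {k} → lambdaℤ n k ≡ lambdaℤ n i → k ≡ i ⊎ k ≡ j
    from {k} eq = map₂
      (λ k+i≡n+1 → ℕ.+-cancelʳ-≡ i k j (trans k+i≡n+1 (trans (sym i+j≡n+1) (ℕ.+-comm i j))))
      (lambdaℤ-fibre n k i eq)

  -- Here `i` is the fixed point of the reflection k ↦ n + 1 - k, so both alternatives of
  -- `lambdaℤ-fibre` give the same layer.
  fibre-one-layer : ∀ {i} → i + i ≡ n + 1 → Layer n i ↔ LambdaFibre n (lambdaℤ n i)
  fibre-one-layer {n} {i} i+i≡n+1 =
    ∃-irrelevant-↔ ℕ.≡-irrelevant ℤ-≡-irrelevant (mk⇔ (cong (lambdaℤ n)) from)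
    where
    from : ∀ {k} → lambdaℤ n k ≡ lambdaℤ n i → k ≡ i
    from {k} eq = fromInj₁
      (λ k+i≡n+1 → ℕ.+-cancelʳ-≡ i k i (trans k+i≡n+1 (sym i+i≡n+1)))
      (lambdaℤ-fibre n k i eq)

  -- The lower half of the indices and the parity of n.

  lambdaℤ-index≤half : ∀ {k} → k ≤ n → ∃ λ i → i ≤ (n + 1) / 2 × lambdaℤ n k ≡ lambdaℤ n i
  lambdaℤ-index≤half {n} {k} k≤n with k ℕ.≤? (n + 1) / 2
  ... | yes k≤half = k , k≤half , refl
  -- An index above the middle is replaced by its mirror image, which has the same value of
  -- `lambdaℤ`.
  ... | no  k≰half = n + 1 ∸ k , reflected≤half ,
    lambdaℤ-reflect n k (n + 1 ∸ k) (ℕ.m+[n∸m]≡n (ℕ.≤-trans k≤n (ℕ.m≤m+n n 1)))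
    where
    q = (n + 1) / 2

    -- The extra 1 bounds the remainder of n + 1 modulo 2; it is absorbed below by k ≥ q + 1.
    n+1≤1+q+q : n + 1 ≤ suc q + q
    n+1≤1+q+q = begin
      n + 1                   ≡⟨ m≡m%n+[m/n]*n (n + 1) 2 ⟩
      (n + 1) % 2 + q * 2     ≤⟨ ℕ.+-monoˡ-≤ (q * 2) (ℕ.≤-pred (m%n<n (n + 1) 2)) ⟩
      1 + q * 2               ≡⟨ cong suc (ℕ.*-comm q 2) ⟩
      1 + (q + (q + 0))       ≡⟨ cong (λ r → 1 + (q + r)) (ℕ.+-identityʳ q) ⟩
      suc q + q               ∎
      where open ℕ.≤-Reasoning

    reflected≤half : n + 1 ∸ k ≤ q
    reflected≤half = ℕ.m≤n+o⇒m∸n≤o (n + 1) k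
      (ℕ.≤-trans n+1≤1+q+q (ℕ.+-monoˡ-≤ q (ℕ.≰⇒> k≰half)))

  m+m≡m*2 : ∀ m → m + m ≡ m * 2
  m+m≡m*2 m = trans (cong (λ r → m + r) (sym (ℕ.+-identityʳ m))) (ℕ.*-comm 2 m)

  2∣m+m : ∀ m → 2 ∣ m + m
  2∣m+m m = divides m (m+m≡m*2 m)

  2∣n⇒2∤n+1 : 2 ∣ n → 2 ∤ n + 1
  2∣n⇒2∤n+1 2∣n 2∣n+1 with () ← ∣1⇒≡1 (∣m+n∣m⇒∣n 2∣n+1 2∣n)

  2∤n⇒half+half≡n+1 : 2 ∤ n → (n + 1) / 2 + (n + 1) / 2 ≡ n + 1
  2∤n⇒half+half≡n+1 {n} 2∤n = trans (m+m≡m*2 ((n + 1) / 2))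
    (m/n*n≡m (fromInj₂ (λ 2∣n → contradiction 2∣n 2∤n) (2∣n⊎2∣n+1 n)))

  i≤half⇒i≤n+1 : ∀ {i} → i ≤ (n + 1) / 2 → i ≤ n + 1
  i≤half⇒i≤n+1 {n} i≤half = ℕ.≤-trans i≤half (ℕ.≤-trans (ℕ.m≤m+n _ _)
    (ℕ.≤-trans (ℕ.≤-reflexive (m+m≡m*2 ((n + 1) / 2))) (m/n*n≤m (n + 1) 2)))

  i<half⇒i+i<n+1 : ∀ {i} → i < (n + 1) / 2 → i + i < n + 1
  i<half⇒i+i<n+1 {n} i<half = ℕ.<-≤-trans (ℕ.+-mono-< i<half i<half)
    (ℕ.≤-trans (ℕ.≤-reflexive (m+m≡m*2 ((n + 1) / 2))) (m/n*n≤m (n + 1) 2))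

  two-layers-enum : ∀ {i} → i ≤ n + 1 → i + i ≢ n + 1 →
    Fin (n C i + n C (n + 1 ∸ i)) ↔ LambdaFibre n (lambdaℤ n i)
  two-layers-enum {n} {i} i≤n+1 2i≢n+1 = fibre-two-layers i+j≡n+1
      (λ i≡j → 2i≢n+1 (trans (cong (λ r → i + r) i≡j) i+j≡n+1))
    ↔-∘ ((layer-enum n i ⊎-↔ layer-enum n (n + 1 ∸ i)) ↔-∘ Fin.+↔⊎)
    where
    i+j≡n+1 : i + (n + 1 ∸ i) ≡ n + 1
    i+j≡n+1 = ℕ.m+[n∸m]≡n i≤n+1

  -- The mirror layer n + 1 is empty, so C(n, 0) + C(n, n + 1) collapses to 1.
  zeroth-layer-enum : ∀ n → Fin 1 ↔ LambdaFibre n (lambdaℤ n 0)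
  zeroth-layer-enum n = subst (λ m → Fin m ↔ LambdaFibre n (lambdaℤ n 0))
    (cong suc (k>n⇒nCk≡0 (ℕ.m<m+n n (s≤s z≤n))))
    (two-layers-enum {n} z≤n (λ 0≡n+1 → ℕ.0≢1+n (trans 0≡n+1 (ℕ.+-comm n 1))))

open Hypercube

module Spectral {c ℓ₁ ℓ₂} (K : HeytingField c ℓ₁ ℓ₂) where

  open HeytingField K using (_#_; #⇒invertible; #-irrefl; #-sym; #-cotrans; heytingCommutativeRing)
  open HeytingCommutativeRingProperties heytingCommutativeRing
    using (x-0≈x; x#0y#0→xy#0; #-congʳ; invertibleˡ⇒#)
  open CommutativeRing (HeytingCommutativeRing.commutativeRing heytingCommutativeRing)
  open AbelianGroupProperties +-abelianGroup
    using (⁻¹-∙-comm; ⁻¹-involutive; ε⁻¹≈ε; x∙y⁻¹≈ε⇒x≈y; x≈y⇒x∙y⁻¹≈ε; xyx⁻¹≈y)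
  open RingProperties ring using (-‿distribˡ-*; [y-z]x≈yx-zx)
  open CommutativeMonoidSum +-commutativeMonoid
    using (sum; sum-cong-≋; ∑-distrib-+; ∑-comm; sum-replicate-zero)
  open SemiringSum semiring using (*-distribˡ-sum; *-distribʳ-sum)
  open Mult +-monoid using (×-homo-+) renaming (_×_ to _×ᴷ_)
  module *-CS = CommutativeSemigroupProperties *-commutativeSemigroup
  module +-CS = CommutativeSemigroupProperties +-commutativeSemigroup
  open Spectrum K hiding (_≈_)
  open SetoidReasoning setoid

  private variable
    n m : ℕ

  -- Apartness from zero in a Heyting field.

  #0-cancelˡ : ∀ {x y} → x # 0# → x * y ≈ 0# → y ≈ 0#
  #0-cancelˡ {x} {y} x#0 xy≈0 with w , w*[x-0]≈1 , _ ← #⇒invertible x#0 = begin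
    y                  ≈⟨ *-identityˡ y ⟨
    1# * y             ≈⟨ *-congʳ w*[x-0]≈1 ⟨
    w * (x - 0#) * y   ≈⟨ *-congʳ (*-congˡ (x-0≈x x)) ⟩
    w * x * y          ≈⟨ *-assoc w x y ⟩
    w * (x * y)        ≈⟨ *-congˡ xy≈0 ⟩
    w * 0#             ≈⟨ zeroʳ w ⟩
    0#                 ∎

  #0-inverse : ∀ {x} → x # 0# → ∃ λ w → w * x ≈ 1#
  #0-inverse {x} x#0 with w , w*[x-0]≈1 , _ ← #⇒invertible x#0 =
    w , trans (*-congˡ (sym (x-0≈x x))) w*[x-0]≈1

  difference#0⇒# : ∀ {x y} → x - y # 0# → x # y
  difference#0⇒# x-y#0 = invertibleˡ⇒# (#0-inverse x-y#0)

  #⇒difference#0 : ∀ {x y} → x # y → x - y # 0#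
  #⇒difference#0 {x} {y} x#y with w , w*[x-y]≈1 , _ ← #⇒invertible x#y =
    invertibleˡ⇒# (w , trans (*-congˡ (x-0≈x (x - y))) w*[x-y]≈1)

  -- Cotransitivity is applied with `y` as the third point: either `y` is apart from 0, or x + y is
  -- apart from `y`, and then the difference x of these two is apart from 0.
  +#0⇒#0⊎#0 : ∀ {x y} → x + y # 0# → x # 0# ⊎ y # 0#
  +#0⇒#0⊎#0 {x} {y} x+y#0 = [ inj₁ ∘ x#0 , inj₂ ]′ (#-cotrans x+y#0 y)
    where
    x#0 : x + y # y → x # 0#
    x#0 x+y#y = #-congʳ (trans (+-congʳ (+-comm x y)) (xyx⁻¹≈y y x)) (#⇒difference#0 x+y#y)

  -- The term is exhibited, not merely shown to be impossible to miss; it later selects the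
  -- character that identifies an eigenvalue.
  sum#0⇒∃#0 : ∀ (f : Fin m → Carrier) → sum f # 0# → ∃ λ i → f i # 0#
  sum#0⇒∃#0 {zero}  f 0#0 = contradiction 0#0 (#-irrefl refl)
  sum#0⇒∃#0 {suc m} f s#0 with +#0⇒#0⊎#0 s#0
  ... | inj₁ f0#0 = Fin.zero , f0#0
  ... | inj₂ s′#0 with i , fi#0 ← sum#0⇒∃#0 (f ∘ Fin.suc) s′#0 = Fin.suc i , fi#0

  -- Additivity of the map from the integers to the field.

  fromℤ-neg : ∀ z → fromℤ (ℤ.- z) ≈ - fromℤ z
  fromℤ-neg (+ zero)    = sym ε⁻¹≈ε
  fromℤ-neg ℤ.+[1+ m ] = refl
  fromℤ-neg -[1+ m ]    = sym (⁻¹-involutive _)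

  -- Integer addition with mixed signs computes to `⊖`, so this is the core of `fromℤ-+`. The
  -- recursion removes one unit from each side, which the field matches by inserting 1 - 1.
  fromℤ-⊖ : ∀ m n → fromℤ (m ⊖ n) ≈ m ×ᴷ 1# - n ×ᴷ 1#
  fromℤ-⊖ zero    zero    = sym (-‿inverseʳ 0#)
  fromℤ-⊖ (suc m) zero    = sym (x-0≈x _)
  fromℤ-⊖ zero    (suc n) = sym (+-identityˡ _)
  fromℤ-⊖ (suc m) (suc n) = begin
    fromℤ (suc m ⊖ suc n)                    ≡⟨ ≡.cong fromℤ (ℤ.[1+m]⊖[1+n]≡m⊖n m n) ⟩
    fromℤ (m ⊖ n)                            ≈⟨ fromℤ-⊖ m n ⟩
    m ×ᴷ 1# - n ×ᴷ 1#                        ≈⟨ +-identityˡ _ ⟨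
    0# + (m ×ᴷ 1# - n ×ᴷ 1#)                 ≈⟨ +-congʳ (-‿inverseʳ 1#) ⟨
    (1# - 1#) + (m ×ᴷ 1# - n ×ᴷ 1#)          ≈⟨ +-CS.interchange _ _ _ _ ⟩
    suc m ×ᴷ 1# + (- 1# - n ×ᴷ 1#)           ≈⟨ +-congˡ (⁻¹-∙-comm _ _) ⟩
    suc m ×ᴷ 1# - suc n ×ᴷ 1#                ∎

  fromℤ-+ : ∀ i j → fromℤ (i ℤ.+ j) ≈ fromℤ i + fromℤ j
  fromℤ-+ (+ m)    (+ n)    = ×-homo-+ 1# m n
  fromℤ-+ (+ m)    -[1+ n ] = fromℤ-⊖ m (suc n)
  fromℤ-+ -[1+ m ] (+ n)    = trans (fromℤ-⊖ n (suc m)) (+-comm _ _)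
  fromℤ-+ -[1+ m ] -[1+ n ] = begin
    - (suc (suc (m ℕ.+ n)) ×ᴷ 1#)             ≡⟨ ≡.cong (λ k → - (suc k ×ᴷ 1#)) (ℕ.+-suc m n) ⟨
    - ((suc m ℕ.+ suc n) ×ᴷ 1#)               ≈⟨ -‿cong (×-homo-+ 1# (suc m) (suc n)) ⟩
    - (suc m ×ᴷ 1# + suc n ×ᴷ 1#)             ≈⟨ ⁻¹-∙-comm _ _ ⟨
    - (suc m ×ᴷ 1#) + - (suc n ×ᴷ 1#)         ∎

  fromℤ-- : ∀ i j → fromℤ (i ℤ.- j) ≈ fromℤ i - fromℤ j
  fromℤ-- i j = trans (fromℤ-+ i (ℤ.- j)) (+-congˡ (fromℤ-neg j))

  -- Finite sums, and sums over the vertices of the cube.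

  sum-++ : ∀ m {k} (f : Fin (m ℕ.+ k) → Carrier) →
    sum f ≈ sum (λ i → f (i ↑ˡ k)) + sum (λ j → f (m ↑ʳ j))
  sum-++ zero    f = sym (+-identityˡ _)
  sum-++ (suc m) f = trans (+-congˡ (sum-++ m (f ∘ Fin.suc))) (sym (+-assoc _ _ _))

  sum-zero : ∀ (f : Fin m → Carrier) → (∀ i → f i ≈ 0#) → sum f ≈ 0#
  sum-zero {m} f f≈0 = trans (sum-cong-≋ {m} {f} {λ _ → 0#} f≈0) (sum-replicate-zero m)

  sum-single : ∀ (f : Fin m → Carrier) i → (∀ j → j ≢ i → f j ≈ 0#) → sum f ≈ f i
  sum-single f Fin.zero    f≈0 =
    trans (+-congˡ (sum-zero (f ∘ Fin.suc) (λ j → f≈0 (Fin.suc j) λ ()))) (+-identityʳ _)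
  sum-single f (Fin.suc i) f≈0 =
    trans (+-cong (f≈0 Fin.zero λ ()) (sum-single (f ∘ Fin.suc) i
      (λ j j≢i → f≈0 (Fin.suc j) (j≢i ∘ Fin.suc-injective)))) (+-identityˡ _)

  vertex : Fin (2 ^ n) → Vec Bool n
  vertex = Inverse.to (enumTuples _)

  index : Vec Bool n → Fin (2 ^ n)
  index = Inverse.from (enumTuples _)

  vertex-index : ∀ (v : Vec Bool n) → vertex (index v) ≡ v
  vertex-index {n} = Inverse.strictlyInverseˡ (enumTuples n)

  index-vertex : ∀ (i : Fin (2 ^ n)) → index (vertex {n} i) ≡ i
  index-vertex {n} = Inverse.strictlyInverseʳ (enumTuples n)

  sumᵥ : (Vec Bool n → Carrier) → Carrier
  sumᵥ f = sum λ i → f (vertex i)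

  sumᵥ-cong : ∀ {f g : Vec Bool n → Carrier} → (∀ v → f v ≈ g v) → sumᵥ f ≈ sumᵥ g
  sumᵥ-cong f≈g = sum-cong-≋ (λ i → f≈g (vertex i))

  sumᵥ-single : ∀ (f : Vec Bool n → Carrier) u → (∀ v → v ≢ u → f v ≈ 0#) → sumᵥ f ≈ f u
  sumᵥ-single {n} f u f≈0 = trans
    (sum-single (f ∘ vertex) (index u) λ i i≢ →
      f≈0 (vertex i) λ p → i≢ (≡.trans (≡.sym (index-vertex {n} i)) (≡.cong index p)))
    (reflexive (≡.cong f (vertex-index u)))

  sumᵥ-zero : ∀ (f : Vec Bool n → Carrier) → (∀ v → f v ≈ 0#) → sumᵥ f ≈ 0#
  sumᵥ-zero {n} f f≈0 = sum-zero (f ∘ vertex {n}) (λ i → f≈0 (vertex i))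

  *-distribˡ-sumᵥ : ∀ a (f : Vec Bool n → Carrier) → a * sumᵥ f ≈ sumᵥ (λ v → a * f v)
  *-distribˡ-sumᵥ {n} a f = *-distribˡ-sum a (f ∘ vertex {n})

  *-distribʳ-sumᵥ : ∀ a (f : Vec Bool n → Carrier) → sumᵥ f * a ≈ sumᵥ (λ v → f v * a)
  *-distribʳ-sumᵥ {n} a f = *-distribʳ-sum a (f ∘ vertex {n})

  sumᵥ-distrib-+ : ∀ (f g : Vec Bool n → Carrier) → sumᵥ (λ v → f v + g v) ≈ sumᵥ f + sumᵥ g
  sumᵥ-distrib-+ {n} f g = ∑-distrib-+ (f ∘ vertex {n}) (g ∘ vertex)

  sumᵥ-comm : ∀ (f : Vec Bool n → Vec Bool n → Carrier) →
    sumᵥ (λ u → sumᵥ λ v → f u v) ≈ sumᵥ λ v → sumᵥ λ u → f u v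
  sumᵥ-comm {n} f = ∑-comm (λ i j → f (vertex {n} i) (vertex {n} j))

  sumᵥ-sum-comm : ∀ (f : Vec Bool n → Fin m → Carrier) →
    sumᵥ (λ u → sum λ j → f u j) ≈ sum λ j → sumᵥ λ u → f u j
  sumᵥ-sum-comm {n} f = ∑-comm (λ i j → f (vertex {n} i) j)

  sumᵥ-suc : ∀ (f : Vec Bool (suc n) → Carrier) →
    sumᵥ f ≈ sumᵥ (f ∘ (false ∷_)) + sumᵥ (f ∘ (true ∷_))
  sumᵥ-suc {n} f = begin
    -- `2 ^ suc n` unfolds to N + (N + 0), hence two splittings and an empty last block.
    sum g
      ≈⟨ sum-++ N g ⟩
    sum {N} (λ i → g (i ↑ˡ (N ℕ.+ 0))) + sum (λ j → g (N ↑ʳ j))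
      ≈⟨ +-congˡ (sum-++ N (λ j → g (N ↑ʳ j))) ⟩
    sum {N} (λ i → g (i ↑ˡ (N ℕ.+ 0))) + (sum {N} (λ i → g (N ↑ʳ (i ↑ˡ 0))) + 0#)
      ≈⟨ +-congˡ (+-identityʳ _) ⟩
    sum {N} (λ i → g (i ↑ˡ (N ℕ.+ 0))) + sum {N} (λ i → g (N ↑ʳ (i ↑ˡ 0)))
      ≈⟨ +-cong (sum-cong-≋ {N} (block Fin.zero)) (sum-cong-≋ {N} (block (Fin.suc Fin.zero))) ⟩
    sumᵥ (f ∘ (false ∷_)) + sumᵥ (f ∘ (true ∷_)) ∎
    where
    N = 2 ^ n

    g : Fin (2 ^ suc n) → Carrier
    g = f ∘ vertex {suc n}

    block : ∀ b i → g (Fin.combine {2} {N} b i) ≈ f (Inverse.to Fin.2↔Bool b ∷ vertex {n} i)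
    block b i = reflexive (≡.cong
      (λ (c , j) → f (Inverse.to Fin.2↔Bool c ∷ vertex {n} j)) (Fin.remQuot-combine {2} {N} b i))

  sumᵥ-split : ∀ b (f : Vec Bool (suc n) → Carrier) →
    sumᵥ f ≈ sumᵥ (f ∘ (b ∷_)) + sumᵥ (f ∘ (not b ∷_))
  sumᵥ-split false f = sumᵥ-suc f
  sumᵥ-split true  f = trans (sumᵥ-suc f) (+-comm _ _)

  -- Reindexing by Kronecker deltas: where `P v` holds, `e` hits `v` exactly once, so `f v` is the
  -- only surviving term of a sum over `j`; swapping the two sums then leaves one vertex for each
  -- `j`.
  sumᵥ-along-↔ : ∀ {P : Vec Bool n → Set} → Irrelevant P → (∀ v → Dec (P v)) →
    (e : Fin m ↔ ∃ P) (f : Vec Bool n → Carrier) → (∀ v → ¬ P v → f v ≈ 0#) →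
    sumᵥ f ≈ sum λ j → f (proj₁ (Inverse.to e j))
  sumᵥ-along-↔ {n} {m} {P} P-irr P? e f f≈0 = begin
    sumᵥ f                                   ≈⟨ sumᵥ-cong expand ⟩
    sumᵥ (λ v → sum λ j → δ j v * f v)       ≈⟨ sumᵥ-sum-comm (λ v j → δ j v * f v) ⟩
    (sum λ j → sumᵥ λ v → δ j v * f v)       ≈⟨ sum-cong-≋ contract ⟩
    (sum λ j → f (b j))                      ∎
    where
    b : Fin m → Vec Bool n
    b j = proj₁ (Inverse.to e j)

    δ : Fin m → Vec Bool n → Carrier
    δ j v = if does (Vec.≡-dec Bool._≟_ (b j) v) then 1# else 0#

    δ≈1 : ∀ {j v} → b j ≡ v → δ j v * f v ≈ f v
    δ≈1 {j} {v} p with Vec.≡-dec Bool._≟_ (b j) v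
    ... | yes _ = *-identityˡ _
    ... | no ¬p = contradiction p ¬p

    δ≈0 : ∀ {j v} → b j ≢ v → δ j v * f v ≈ 0#
    δ≈0 {j} {v} ¬p with Vec.≡-dec Bool._≟_ (b j) v
    ... | yes p = contradiction p ¬p
    ... | no _  = zeroˡ _

    expand : ∀ v → f v ≈ sum λ j → δ j v * f v
    expand v with P? v
    ... | no ¬p = trans (f≈0 v ¬p)
      (sym (sum-zero (λ j → δ j v * f v) λ j → trans (*-congˡ (f≈0 v ¬p)) (zeroʳ _)))
    ... | yes p = sym (trans
      (sum-single (λ j → δ j v * f v) (Inverse.from e (v , p)) (λ j j≢ → δ≈0 (j≢ ∘ unique j)))
      (δ≈1 (≡.cong proj₁ (Inverse.strictlyInverseˡ e (v , p)))))
      where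
      unique : ∀ j → b j ≡ v → j ≡ Inverse.from e (v , p)
      unique j ≡.refl = ≡.trans (≡.sym (Inverse.strictlyInverseʳ e j))
        (≡.cong (λ q → Inverse.from e (v , q)) (P-irr _ p))

    contract : ∀ j → sumᵥ (λ v → δ j v * f v) ≈ f (b j)
    contract j = trans (sumᵥ-single (λ v → δ j v * f v) (b j) λ v v≢ → δ≈0 (v≢ ∘ ≡.sym)) (δ≈1 ≡.refl)

  -- Characters and their orthogonality.

  ε : Bool → Bool → Carrier
  ε true true = - 1#
  ε _    _    = 1#

  -- The character (-1)^(S·v) as a product over the coordinates, where `ε s b` is (-1)^(sb).
  χ : Vec Bool n → Vec Bool n → Carrier
  χ []      []      = 1#
  χ (s ∷ S) (b ∷ v) = ε s b * χ S v

  ε-sym : ∀ s b → ε s b ≡ ε b s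
  ε-sym true  true  = ≡.refl
  ε-sym true  false = ≡.refl
  ε-sym false true  = ≡.refl
  ε-sym false false = ≡.refl

  -- Through this symmetry, orthogonality of characters also serves as the orthogonality over all
  -- `S` in Fourier inversion.
  χ-sym : ∀ (S v : Vec Bool n) → χ S v ≡ χ v S
  χ-sym []      []      = ≡.refl
  χ-sym (s ∷ S) (b ∷ v) = ≡.cong₂ _*_ (ε-sym s b) (χ-sym S v)

  -1*-1≈1 : - 1# * - 1# ≈ 1#
  -1*-1≈1 = begin
    - 1# * - 1#      ≈⟨ -‿distribˡ-* 1# (- 1#) ⟨
    - (1# * - 1#)    ≈⟨ -‿cong (*-identityˡ _) ⟩
    - - 1#           ≈⟨ ⁻¹-involutive 1# ⟩
    1#               ∎

  ε-square : ∀ s b → ε s b * ε s b ≈ 1#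
  ε-square true  true  = -1*-1≈1
  ε-square true  false = *-identityˡ 1#
  ε-square false b     = *-identityˡ 1#

  ε-orthogonal : ∀ {s t} → s ≢ t → ε s false * ε t false + ε s true * ε t true ≈ 0#
  ε-orthogonal {true}  {true}  s≢t = contradiction ≡.refl s≢t
  ε-orthogonal {false} {false} s≢t = contradiction ≡.refl s≢t
  ε-orthogonal {true}  {false} _   = trans (+-cong (*-identityˡ 1#) (*-identityʳ _)) (-‿inverseʳ 1#)
  ε-orthogonal {false} {true}  _   = trans (+-cong (*-identityˡ 1#) (*-identityˡ _)) (-‿inverseʳ 1#)

  inner-suc : ∀ s t (S T : Vec Bool n) →
    sumᵥ (λ v → χ (s ∷ S) v * χ (t ∷ T) v) ≈
    ε s false * ε t false * sumᵥ (λ v → χ S v * χ T v) +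
    ε s true  * ε t true  * sumᵥ (λ v → χ S v * χ T v)
  inner-suc s t S T = trans (sumᵥ-suc (λ v → χ (s ∷ S) v * χ (t ∷ T) v))
    (+-cong (half false) (half true))
    where
    half : ∀ b → sumᵥ (λ v → (ε s b * χ S v) * (ε t b * χ T v)) ≈
                 ε s b * ε t b * sumᵥ (λ v → χ S v * χ T v)
    half b = trans
      (sumᵥ-cong λ v → *-CS.interchange (ε s b) (χ S v) (ε t b) (χ T v))
      (sym (*-distribˡ-sumᵥ (ε s b * ε t b) (λ v → χ S v * χ T v)))

  -- If the heads differ, the halves of the sum with first coordinate false and true have opposite
  -- signs. If they agree, the tails differ and both halves vanish by induction.
  χ-orthogonal : ∀ (S T : Vec Bool n) → S ≢ T → sumᵥ (λ v → χ S v * χ T v) ≈ 0#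
  χ-orthogonal []      []      S≢T = contradiction ≡.refl S≢T
  χ-orthogonal (s ∷ S) (t ∷ T) S≢T with s Bool.≟ t
  ... | no s≢t = begin
    sumᵥ (λ v → χ (s ∷ S) v * χ (t ∷ T) v)  ≈⟨ inner-suc s t S T ⟩
    ε s false * ε t false * _ + ε s true * ε t true * _  ≈⟨ distribʳ _ _ _ ⟨
    (ε s false * ε t false + ε s true * ε t true) * _    ≈⟨ *-congʳ (ε-orthogonal s≢t) ⟩
    0# * _                                  ≈⟨ zeroˡ _ ⟩
    0#                                      ∎
  ... | yes ≡.refl = begin
    sumᵥ (λ v → χ (s ∷ S) v * χ (s ∷ T) v)  ≈⟨ inner-suc s s S T ⟩
    ε s false * ε s false * _ + ε s true * ε s true * _  ≈⟨ +-cong (*-congˡ S⊥T) (*-congˡ S⊥T) ⟩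
    ε s false * ε s false * 0# + ε s true * ε s true * 0#  ≈⟨ +-cong (zeroʳ _) (zeroʳ _) ⟩
    0# + 0#                                 ≈⟨ +-identityˡ 0# ⟩
    0#                                      ∎
    where
    S⊥T : sumᵥ (λ v → χ S v * χ T v) ≈ 0#
    S⊥T = χ-orthogonal S T (λ p → S≢T (≡.cong (s ∷_) p))

  order : ℕ → Carrier
  order n = (2 ^ n) ×ᴷ 1#

  χ-norm : ∀ (S : Vec Bool n) → sumᵥ (λ v → χ S v * χ S v) ≈ order n
  χ-norm []      = +-congʳ (*-identityˡ 1#)
  χ-norm {suc n} (s ∷ S) = begin
    sumᵥ (λ v → χ (s ∷ S) v * χ (s ∷ S) v)  ≈⟨ inner-suc s s S S ⟩
    ε s false * ε s false * _ + ε s true * ε s true * _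
      ≈⟨ +-cong (*-cong (ε-square s false) (χ-norm S)) (*-cong (ε-square s true) (χ-norm S)) ⟩
    1# * order n + 1# * order n             ≈⟨ +-cong (*-identityˡ _) (*-identityˡ _) ⟩
    -- The added zero matches the unfolding of 2 ^ suc n to 2 ^ n + (2 ^ n + 0).
    order n + order n                       ≈⟨ +-congˡ (+-identityʳ (order n)) ⟨
    order n + (order n + 0#)                ≈⟨ +-congˡ (×-homo-+ 1# (2 ^ n) 0) ⟨
    order n + (2 ^ n ℕ.+ 0) ×ᴷ 1#           ≈⟨ ×-homo-+ 1# (2 ^ n) (2 ^ n ℕ.+ 0) ⟨
    order (suc n)                           ∎

  -- Hamming spheres acting on characters.

  sphere : ℕ → Vec Bool n → Vec Bool n → Carrier
  sphere k u v = if does (hamming u v ℕ.≟ k) then 1# else 0#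

  sphere-same : ∀ b k (u v : Vec Bool n) → sphere k (b ∷ u) (b ∷ v) ≡ sphere k u v
  sphere-same true  k u v = ≡.refl
  sphere-same false k u v = ≡.refl

  sphere-zero-flip : ∀ b (u v : Vec Bool n) → sphere 0 (b ∷ u) (not b ∷ v) ≡ 0#
  sphere-zero-flip true  u v = ≡.refl
  sphere-zero-flip false u v = ≡.refl

  sphere-suc-flip : ∀ b k (u v : Vec Bool n) → sphere (suc k) (b ∷ u) (not b ∷ v) ≡ sphere k u v
  sphere-suc-flip true  k u v = ≡.refl
  sphere-suc-flip false k u v = ≡.refl

  -- A point at distance k + 1 from b ∷ u either keeps `b` and has its tail at distance k + 1, or
  -- flips `b` and has its tail at distance k. Flipping `b` negates `ε s b` exactly when `s` is
  -- true, which is the sign in the recurrence of `krawtchouk`.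
  krawtchouk-step : ∀ s b k (S : Vec Bool n) →
    ε s b * fromℤ (krawtchouk (suc k) S) + ε s (not b) * fromℤ (krawtchouk k S) ≈
    fromℤ (krawtchouk (suc k) (s ∷ S)) * ε s b
  krawtchouk-step false b k S = begin
    1# * x + 1# * y   ≈⟨ +-cong (*-identityˡ x) (*-identityˡ y) ⟩
    x + y             ≈⟨ fromℤ-+ (krawtchouk (suc k) S) (krawtchouk k S) ⟨
    fromℤ (krawtchouk (suc k) (false ∷ S))       ≈⟨ *-identityʳ _ ⟨
    fromℤ (krawtchouk (suc k) (false ∷ S)) * 1#  ∎
    where
    x = fromℤ (krawtchouk (suc k) S)
    y = fromℤ (krawtchouk k S)
  krawtchouk-step true b k S = begin
    ε true b * x + ε true (not b) * y  ≈⟨ +-congˡ (*-congʳ (flip b)) ⟩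
    ε true b * x + (- ε true b) * y    ≈⟨ +-congˡ (-‿distribˡ-* (ε true b) y) ⟨
    ε true b * x - ε true b * y        ≈⟨ +-cong (*-comm _ x) (-‿cong (*-comm _ y)) ⟩
    x * ε true b - y * ε true b        ≈⟨ [y-z]x≈yx-zx (ε true b) x y ⟨
    (x - y) * ε true b                 ≈⟨ *-congʳ (fromℤ-- (krawtchouk (suc k) S) (krawtchouk k S)) ⟨
    fromℤ (krawtchouk (suc k) (true ∷ S)) * ε true b  ∎
    where
    x = fromℤ (krawtchouk (suc k) S)
    y = fromℤ (krawtchouk k S)

    flip : ∀ b → ε true (not b) ≈ - ε true b
    flip true  = sym (⁻¹-involutive 1#)
    flip false = refl

  sphere-χ : ∀ k (S u : Vec Bool n) →
    sumᵥ (λ v → sphere k u v * χ S v) ≈ fromℤ (krawtchouk k S) * χ S u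
  sphere-χ zero    [] [] = trans (+-identityʳ _) (*-congʳ (sym (+-identityʳ 1#)))
  sphere-χ (suc k) [] [] = +-identityʳ _
  sphere-χ {suc n} k (s ∷ S) (b ∷ u) = trans
    (sumᵥ-split b (λ v → sphere k (b ∷ u) v * χ (s ∷ S) v))
    (trans (+-congʳ same) (by-radius k))
    where
    -- `g` stands for either half of the sum: the radius stays the same where the head is kept and
    -- drops by one where it is flipped.
    pull : ∀ j c (g : Vec Bool n → Carrier) → (∀ v → g v ≡ sphere j u v) →
      sumᵥ (λ v → g v * (ε s c * χ S v)) ≈ ε s c * fromℤ (krawtchouk j S) * χ S u
    pull j c g g≡ = begin
      sumᵥ (λ v → g v * (ε s c * χ S v))
        ≈⟨ sumᵥ-cong (λ v → trans
             (*-congʳ (reflexive (g≡ v)))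
             (*-CS.x∙yz≈y∙xz (sphere j u v) (ε s c) (χ S v))) ⟩
      sumᵥ (λ v → ε s c * (sphere j u v * χ S v))
        ≈⟨ *-distribˡ-sumᵥ (ε s c) (λ v → sphere j u v * χ S v) ⟨
      ε s c * sumᵥ (λ v → sphere j u v * χ S v)
        ≈⟨ *-congˡ (sphere-χ j S u) ⟩
      ε s c * (fromℤ (krawtchouk j S) * χ S u)
        ≈⟨ *-assoc _ _ _ ⟨
      ε s c * fromℤ (krawtchouk j S) * χ S u ∎

    same : sumᵥ (λ v → sphere k (b ∷ u) (b ∷ v) * (ε s b * χ S v)) ≈
           ε s b * fromℤ (krawtchouk k S) * χ S u
    same = pull k b _ (sphere-same b k u)

    by-radius : ∀ k →
      ε s b * fromℤ (krawtchouk k S) * χ S u +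
      sumᵥ (λ v → sphere k (b ∷ u) (not b ∷ v) * (ε s (not b) * χ S v)) ≈
      fromℤ (krawtchouk k (s ∷ S)) * (ε s b * χ S u)
    -- No point with a flipped head lies at distance 0, so only the kept half contributes.
    by-radius zero = begin
      _ + sumᵥ (λ v → sphere 0 (b ∷ u) (not b ∷ v) * (ε s (not b) * χ S v))
        ≈⟨ +-congˡ (sumᵥ-zero (λ v → sphere 0 (b ∷ u) (not b ∷ v) * (ε s (not b) * χ S v))
             λ v → trans (*-congʳ (reflexive (sphere-zero-flip b u v))) (zeroˡ _)) ⟩
      ε s b * fromℤ (+ 1) * χ S u + 0#       ≈⟨ +-identityʳ _ ⟩
      ε s b * fromℤ (+ 1) * χ S u            ≈⟨ *-congʳ (*-comm _ _) ⟩
      fromℤ (+ 1) * ε s b * χ S u            ≈⟨ *-assoc _ _ _ ⟩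
      fromℤ (+ 1) * (ε s b * χ S u)          ∎
    by-radius (suc k) = begin
      ε s b * x * χ S u + sumᵥ (λ v → sphere (suc k) (b ∷ u) (not b ∷ v) * (ε s (not b) * χ S v))
        ≈⟨ +-congˡ (pull k (not b) _ (sphere-suc-flip b k u)) ⟩
      ε s b * x * χ S u + ε s (not b) * y * χ S u
        ≈⟨ distribʳ _ _ _ ⟨
      (ε s b * x + ε s (not b) * y) * χ S u
        ≈⟨ *-congʳ (krawtchouk-step s b k S) ⟩
      fromℤ (krawtchouk (suc k) (s ∷ S)) * ε s b * χ S u
        ≈⟨ *-assoc _ _ _ ⟩
      fromℤ (krawtchouk (suc k) (s ∷ S)) * (ε s b * χ S u) ∎
      where
      x = fromℤ (krawtchouk (suc k) S)
      y = fromℤ (krawtchouk k S)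

  A² : Vec Bool n → Vec Bool n → Carrier
  A² {n} = adjacencyMatrix (Q n ²)

  -- The adjacency matrix decides by searching for walks; `does-⇔` replaces this by tests of the
  -- Hamming distance, since decisions of equivalent propositions have the same truth value.
  -- Distances 1 and 2 exclude each other, so the indicators add.
  A²-spheres : ∀ (u v : Vec Bool n) → A² u v ≈ sphere 1 u v + sphere 2 u v
  A²-spheres {n} u v = trans
    (reflexive (≡.cong (if_then 1# else 0#) (does-⇔ (Adj²⇔hamming u v)
      (FiniteSimpleGraph.adj? (Q n ²) u v) ((hamming u v ℕ.≟ 1) ⊎-dec (hamming u v ℕ.≟ 2)))))
    (by-distance (hamming u v))
    where
    by-distance : ∀ h → (if does ((h ℕ.≟ 1) ⊎-dec (h ℕ.≟ 2)) then 1# else 0#) ≈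
      (if does (h ℕ.≟ 1) then 1# else 0#) + (if does (h ℕ.≟ 2) then 1# else 0#)
    by-distance 0 = sym (+-identityˡ 0#)
    by-distance 1 = sym (+-identityʳ 1#)
    by-distance 2 = sym (+-identityˡ 1#)
    by-distance (suc (suc (suc h))) = sym (+-identityˡ 0#)

  A²-sym : ∀ (u v : Vec Bool n) → A² u v ≈ A² v u
  A²-sym u v = begin
    A² u v                                ≈⟨ A²-spheres u v ⟩
    sphere 1 u v + sphere 2 u v           ≡⟨ ≡.cong (λ h → at 1 h + at 2 h) (hamming-sym u v) ⟩
    sphere 1 v u + sphere 2 v u           ≈⟨ A²-spheres v u ⟨
    A² v u                                ∎
    where
    at : ℕ → ℕ → Carrier
    at k h = if does (h ℕ.≟ k) then 1# else 0#

  χ-eigenvector : ∀ (S : Vec Bool n) → InEigenspace (Q n ²) (lambda n ∣ S ∣) (χ S)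
  χ-eigenvector {n} S u = begin
    sumᵥ (λ v → A² u v * χ S v)
      ≈⟨ sumᵥ-cong (λ v → trans
           (*-congʳ (A²-spheres u v))
           (distribʳ (χ S v) (sphere 1 u v) (sphere 2 u v))) ⟩
    sumᵥ (λ v → sphere 1 u v * χ S v + sphere 2 u v * χ S v)
      ≈⟨ sumᵥ-distrib-+ (λ v → sphere 1 u v * χ S v) (λ v → sphere 2 u v * χ S v) ⟩
    sumᵥ (λ v → sphere 1 u v * χ S v) + sumᵥ (λ v → sphere 2 u v * χ S v)
      ≈⟨ +-cong (sphere-χ 1 S u) (sphere-χ 2 S u) ⟩
    fromℤ (krawtchouk 1 S) * χ S u + fromℤ (krawtchouk 2 S) * χ S u
      ≈⟨ distribʳ (χ S u) (fromℤ (krawtchouk 1 S)) (fromℤ (krawtchouk 2 S)) ⟨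
    (fromℤ (krawtchouk 1 S) + fromℤ (krawtchouk 2 S)) * χ S u
      ≈⟨ *-congʳ (fromℤ-+ (krawtchouk 1 S) (krawtchouk 2 S)) ⟨
    fromℤ (krawtchouk 1 S ℤ.+ krawtchouk 2 S) * χ S u
      ≡⟨ ≡.cong (λ z → fromℤ z * χ S u) (krawtchouk₁+₂ S) ⟩
    lambda n ∣ S ∣ * χ S u ∎

  -- Fourier transform of an eigenvector.

  fourier : (Vec Bool n → Carrier) → Vec Bool n → Carrier
  fourier x S = sumᵥ λ v → χ S v * x v

  -- The transform is not normalised, whence the factor 2ⁿ. Once the sums are swapped, the inner one
  -- pairs the characters of `v` and `u`, and only v = u survives.
  fourier-inversion : ∀ (x : Vec Bool n → Carrier) u →
    sumᵥ (λ S → fourier x S * χ S u) ≈ order n * x u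
  fourier-inversion {n} x u = begin
    sumᵥ (λ S → fourier x S * χ S u)
      ≈⟨ sumᵥ-cong (λ S → *-distribʳ-sumᵥ (χ S u) (λ v → χ S v * x v)) ⟩
    sumᵥ (λ S → sumᵥ λ v → χ S v * x v * χ S u)
      ≈⟨ sumᵥ-comm (λ S v → χ S v * x v * χ S u) ⟩
    sumᵥ (λ v → sumᵥ λ S → χ S v * x v * χ S u)
      ≈⟨ sumᵥ-cong collect ⟩
    sumᵥ (λ v → sumᵥ (λ S → χ v S * χ u S) * x v)
      ≈⟨ sumᵥ-single (λ v → sumᵥ (λ S → χ v S * χ u S) * x v) u
           (λ v v≢u → trans (*-congʳ (χ-orthogonal v u v≢u)) (zeroˡ (x v))) ⟩
    sumᵥ (λ S → χ u S * χ u S) * x u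
      ≈⟨ *-congʳ (χ-norm u) ⟩
    order n * x u ∎
    where
    collect : ∀ v → sumᵥ (λ S → χ S v * x v * χ S u) ≈ sumᵥ (λ S → χ v S * χ u S) * x v
    collect v = trans
      (sumᵥ-cong {n} λ S → trans (*-CS.xy∙z≈xz∙y (χ S v) (x v) (χ S u))
        (*-congʳ (reflexive (≡.cong₂ _*_ (χ-sym S v) (χ-sym S u)))))
      (sym (*-distribʳ-sumᵥ (x v) (λ S → χ v S * χ u S)))

  -- Self-adjointness: pairing A χ_S with x gives the same sum as pairing χ_S with A x, and both are
  -- multiples of the Fourier coefficient at `S`.
  fourier-eigen : ∀ {μ} (x : Vec Bool n → Carrier) → InEigenspace (Q n ²) μ x →
    ∀ S → (lambda n ∣ S ∣ - μ) * fourier x S ≈ 0#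
  fourier-eigen {n} {μ} x Ax≈μx S = trans ([y-z]x≈yx-zx _ _ _) (x≈y⇒x∙y⁻¹≈ε (begin
    lambda n ∣ S ∣ * fourier x S
      ≈⟨ *-distribˡ-sumᵥ (lambda n ∣ S ∣) (λ u → χ S u * x u) ⟩
    sumᵥ (λ u → lambda n ∣ S ∣ * (χ S u * x u))
      ≈⟨ sumᵥ-cong (λ u → trans
           (sym (*-assoc (lambda n ∣ S ∣) (χ S u) (x u)))
           (*-congʳ (sym (χ-eigenvector S u)))) ⟩
    sumᵥ (λ u → sumᵥ (λ v → A² u v * χ S v) * x u)
      ≈⟨ sumᵥ-cong (λ u → *-distribʳ-sumᵥ (x u) (λ v → A² u v * χ S v)) ⟩
    sumᵥ (λ u → sumᵥ λ v → A² u v * χ S v * x u)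
      ≈⟨ sumᵥ-comm (λ u v → A² u v * χ S v * x u) ⟩
    sumᵥ (λ v → sumᵥ λ u → A² u v * χ S v * x u)
      ≈⟨ sumᵥ-cong collect ⟩
    sumᵥ (λ v → μ * (χ S v * x v))
      ≈⟨ *-distribˡ-sumᵥ μ (λ v → χ S v * x v) ⟨
    μ * fourier x S ∎))
    where
    collect : ∀ v → sumᵥ (λ u → A² u v * χ S v * x u) ≈ μ * (χ S v * x v)
    collect v = begin
      sumᵥ (λ u → A² u v * χ S v * x u)
        ≈⟨ sumᵥ-cong (λ u → trans
             (*-congʳ (trans (*-congʳ (A²-sym u v)) (*-comm (A² v u) (χ S v))))
             (*-assoc (χ S v) (A² v u) (x u))) ⟩
      sumᵥ (λ u → χ S v * (A² v u * x u))
        ≈⟨ *-distribˡ-sumᵥ (χ S v) (λ u → A² v u * x u) ⟨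
      χ S v * sumᵥ (λ u → A² v u * x u)
        ≈⟨ *-congˡ (Ax≈μx v) ⟩
      χ S v * (μ * x v)
        ≈⟨ *-CS.x∙yz≈y∙xz _ _ _ ⟩
      μ * (χ S v * x v) ∎

  -- Eigenvalues and multiplicities in characteristic zero.

  module _ (char0 : CharacteristicZero) where

    fromℤ-#0 : ∀ z → z ≢ + 0 → fromℤ z # 0#
    fromℤ-#0 (+ zero)   z≢0 = contradiction ≡.refl z≢0
    fromℤ-#0 ℤ.+[1+ m ] _   = char0 m
    fromℤ-#0 -[1+ m ]   _   =
      #-congʳ (+-identityˡ _) (#⇒difference#0 (#-sym (char0 m)))

    fromℤ-# : ∀ {i j} → i ≢ j → fromℤ i # fromℤ j
    fromℤ-# {i} {j} i≢j = difference#0⇒#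
      (#-congʳ (fromℤ-- i j) (fromℤ-#0 (i ℤ.- j) (i≢j ∘ ℤ.i-j≡0⇒i≡j i j)))

    order#0 : ∀ n → order n # 0#
    order#0 n with 2 ^ n | ℕ.m^n≢0 2 n
    ... | suc m | _ = char0 m

    -- Where the eigenvector is apart from 0, so is the inversion sum, hence also one of its terms;
    -- the character in that term must have eigenvalue μ.
    eigenvalue-form : ∀ {μ} → IsEigenvalue (Q n ²) μ → ∃ λ i → i ℕ.≤ (n ℕ.+ 1) / 2 × μ ≈ lambda n i
    eigenvalue-form {n} {μ} (x , (u , xu#0) , Ax≈μx)
      with i , term#0 ← sum#0⇒∃#0 (λ i → fourier x (vertex i) * χ (vertex i) u)
             (#-congʳ (sym (fourier-inversion x u)) (x#0y#0→xy#0 (order#0 n) xu#0))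
      with j , j≤half , λ≡ ← lambdaℤ-index≤half (∣p∣≤n (vertex {n} i))
      = j , j≤half , trans (sym λ≈μ) (reflexive (≡.cong fromℤ λ≡))
      where
      S = vertex {n} i

      λ≈μ : lambda n ∣ S ∣ ≈ μ
      -- The whole term is cancelled, including its factor `χ S u`, so the Fourier coefficient need
      -- not be shown apart from 0 by itself.
      λ≈μ = x∙y⁻¹≈ε⇒x≈y _ _ (#0-cancelˡ term#0 (begin
        fourier x S * χ S u * (lambda n ∣ S ∣ - μ)    ≈⟨ *-CS.xy∙z≈zx∙y _ _ _ ⟩
        (lambda n ∣ S ∣ - μ) * fourier x S * χ S u    ≈⟨ *-congʳ (fourier-eigen x Ax≈μx S) ⟩
        0# * χ S u                                    ≈⟨ zeroˡ _ ⟩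
        0#                                            ∎))

    fibre-multiplicity : ∀ z → Fin m ↔ LambdaFibre n z → HasMultiplicity (Q n ²) (fromℤ z) m
    fibre-multiplicity {m} {n} z e = (λ j → χ (b j)) , eigen , independent , spanning
      where
      b : Fin m → Vec Bool n
      b j = proj₁ (Inverse.to e j)

      b-injective : ∀ {i j} → b i ≡ b j → i ≡ j
      b-injective {i} {j} p = ≡.trans (≡.sym (Inverse.strictlyInverseʳ e i))
        (≡.trans (≡.cong (Inverse.from e) (fibre-≡ p)) (Inverse.strictlyInverseʳ e j))
        where
        fibre-≡ : ∀ {x y : LambdaFibre n z} → proj₁ x ≡ proj₁ y → x ≡ y
        fibre-≡ {S , p} {_ , q} ≡.refl = ≡.cong (S ,_) (ℤ-≡-irrelevant p q)

      eigen : ∀ j → InEigenspace (Q n ²) (fromℤ z) (χ (b j))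
      eigen j u = trans (χ-eigenvector (b j) u)
        (*-congʳ (reflexive (≡.cong fromℤ (proj₂ (Inverse.to e j)))))

      independent : LinearlyIndependent (Q n ²) (λ j → χ (b j))
      -- Pairing the vanishing combination with the `k`-th character isolates 2ⁿ times its
      -- coefficient.
      independent a comb≈0 k = #0-cancelˡ (order#0 n) (sym (begin
        0#
          ≈⟨ sumᵥ-zero (λ u → comb u * χ (b k) u) (λ u → trans (*-congʳ (comb≈0 u)) (zeroˡ _)) ⟨
        sumᵥ (λ u → comb u * χ (b k) u)
          ≈⟨ sumᵥ-cong (λ u → *-distribʳ-sum (χ (b k) u) (λ j → a j * χ (b j) u)) ⟩
        sumᵥ (λ u → sum λ j → a j * χ (b j) u * χ (b k) u)
          ≈⟨ sumᵥ-sum-comm (λ u j → a j * χ (b j) u * χ (b k) u) ⟩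
        (sum λ j → sumᵥ λ u → a j * χ (b j) u * χ (b k) u)
          ≈⟨ sum-cong-≋ (λ j → trans (sumᵥ-cong {n} (λ u → *-assoc (a j) (χ (b j) u) (χ (b k) u)))
               (sym (*-distribˡ-sumᵥ (a j) (λ u → χ (b j) u * χ (b k) u)))) ⟩
        (sum λ j → a j * sumᵥ λ u → χ (b j) u * χ (b k) u)
          ≈⟨ sum-single (λ j → a j * sumᵥ λ u → χ (b j) u * χ (b k) u) k
               (λ j j≢k → trans (*-congˡ (χ-orthogonal (b j) (b k) (j≢k ∘ b-injective))) (zeroʳ (a j))) ⟩
        a k * sumᵥ (λ u → χ (b k) u * χ (b k) u)
          ≈⟨ trans (*-congˡ (χ-norm (b k))) (*-comm _ _) ⟩
        order n * a k ∎))
        where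
        comb : Vec Bool n → Carrier
        comb = linearCombination (Q n ²) a (λ j → χ (b j))

      spanning : ∀ x → InEigenspace (Q n ²) (fromℤ z) x →
        ∃ λ a → ∀ u → x u ≈ linearCombination (Q n ²) a (λ j → χ (b j)) u
      -- Dividing the inversion formula by 2ⁿ expresses x through all characters; those off the
      -- fibre drop out by `vanish`.
      spanning x Ax≈zx with w , w*N≈1 ← #0-inverse (order#0 n) =
        (λ j → w * fourier x (b j)) , λ u → begin
        x u
          ≈⟨ *-identityˡ (x u) ⟨
        1# * x u
          ≈⟨ *-congʳ w*N≈1 ⟨
        w * order n * x u
          ≈⟨ *-assoc _ _ _ ⟩
        w * (order n * x u)
          ≈⟨ *-congˡ (fourier-inversion x u) ⟨
        w * sumᵥ (λ S → fourier x S * χ S u)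
          ≈⟨ *-congˡ (sumᵥ-along-↔ ℤ-≡-irrelevant (λ S → lambdaℤ n ∣ S ∣ ℤ.≟ z) e
               (λ S → fourier x S * χ S u)
               (λ S λ≢z → trans (*-congʳ (vanish S λ≢z)) (zeroˡ _))) ⟩
        w * sum (λ j → fourier x (b j) * χ (b j) u)
          ≈⟨ *-distribˡ-sum w (λ j → fourier x (b j) * χ (b j) u) ⟩
        (sum λ j → w * (fourier x (b j) * χ (b j) u))
          ≈⟨ sum-cong-≋ (λ j → *-assoc w (fourier x (b j)) (χ (b j) u)) ⟨
        (sum λ j → w * fourier x (b j) * χ (b j) u) ∎
        where
        -- Distinct integers stay apart in characteristic zero, so the scalar in `fourier-eigen` can
        -- be cancelled.
        vanish : ∀ S → lambdaℤ n ∣ S ∣ ≢ z → fourier x S ≈ 0#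
        vanish S λ≢z = #0-cancelˡ (#⇒difference#0 (fromℤ-# λ≢z)) (fourier-eigen x Ax≈zx S)

open import Data.Nat.Base using (_+_; _∸_; _≤_; _<_; _>_)

theorem4p1 : ∀ {c ℓ₁ ℓ₂} (K : HeytingField c ℓ₁ ℓ₂) → let open Spectrum K in
    CharacteristicZero → ∀ n → n > 3 →
    (∀ μ → IsEigenvalue (Q n ²) μ →
    ∃ λ i → i ≤ (n + 1) / 2 × μ ≈ lambda n i)
    × HasMultiplicity (Q n ²) (lambda n 0) 1
    × (2 ∣ n → ∀ i → 1 ≤ i → i ≤ (n + 1) / 2 →
    HasMultiplicity (Q n ²) (lambda n i) (n C i + n C (n + 1 ∸ i)))
    × (2 ∤ n →
    (∀ i → 1 ≤ i → i < (n + 1) / 2 →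
    HasMultiplicity (Q n ²) (lambda n i) (n C i + n C (n + 1 ∸ i)))
    × HasMultiplicity (Q n ²) (lambda n ((n + 1) / 2)) (n C ((n + 1) / 2)))
theorem4p1 K char0 n _ =
    (λ _ → S.eigenvalue-form char0)
  , multiplicity 0 (zeroth-layer-enum n)
  -- For even n the sum n + 1 is odd, so no index is its own mirror image and the two layers are
  -- distinct.
  , (λ 2∣n i _ i≤half → multiplicity i (two-layers-enum (i≤half⇒i≤n+1 i≤half)
      λ 2i≡n+1 → 2∣n⇒2∤n+1 2∣n (≡.subst (2 ∣_) 2i≡n+1 (2∣m+m i))))
  , λ 2∤n →
      (λ i _ i<half → multiplicity i (two-layers-enum (i≤half⇒i≤n+1 (ℕ.<⇒≤ i<half))
        (ℕ.<⇒≢ (i<half⇒i+i<n+1 i<half))))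
    -- For odd n the middle index is its own mirror image, so its fibre is a single layer.
    , multiplicity ((n + 1) / 2)
        (fibre-one-layer (2∤n⇒half+half≡n+1 2∤n) ↔-∘ layer-enum n ((n + 1) / 2))
  where
  module S = Spectral K

  multiplicity : ∀ {m} i → Fin m ↔ LambdaFibre n (lambdaℤ n i) →
    Spectrum.HasMultiplicity K (Q n ²) (Spectrum.lambda K n i) m
  multiplicity i = S.fibre-multiplicity char0 (lambdaℤ n i)
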